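{- Let $T$ be an $\omega_1$-Aronszajn tree that is semi-special but not special and let $G=T\#\mathbb{N}$. Let $S$ be a special $\omega_1$-Aronszajn tree and let $H=S\#\mathbb{N}$ (built from a partition of $S$ into countably many antichains). Then no graph isomorphic to $G$ is a subdivision of $H$.
   Context: Trees, $\omega_1$-trees, Aronszajn trees as usual; $T^\alpha$ is the level $\alpha$. $T$ is special if it is a union of countably many antichains, semi-special if its successor nodes form a union of countably many antichains. Given a tree $T$ and antichains $\langle A_n:n\in\omega\rangle$ whose union contains all successor nodes, for each node $v$ of limit height define $C(T,v)=\{c^{T,v}_n:n\in\omega\}$ recursively: $l_0$ least with $A_{l_0}\cap[\mathrm{root},v)\ne\emptyset$, $c_0^{T,v}\in A_{l_0}\cap[\mathrm{root},v)$; $l_{n+1}$ least with $A_{l_{n+1}}\cap(c_n^{T,v},v)\neq\emptyset$, $c_{n+1}^{T,v}\in A_{l_{n+1}}\cap(c_n^{T,v},v)$. The ray inflation $T\#\mathbb{N}$ has vertex set $T\times\omega$ and edges $\{(u,n),(u,n+1)\}$; $\{(u,n),(v,n)\}$ for all $n$ whenever $u$ is the predecessor of $v$; and $\{(c^{T,v}_n,n),(v,n)\}$ for $v$ of limit height and $n\in\omega$. $S\#\mathbb{N}$ is defined identically from $S$ and its antichain partition. A subdivision of $H$ is obtained by replacing edges of $H$ by paths with new internal vertices. -}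

module Defs where

open import Data.Empty using (⊥)
open import Data.Nat.Base using (ℕ; zero; suc; _+_; _∸_; _≤_)
import Data.Nat.Base as ℕ using (_<_)
open import Data.Product.Base using (Σ; ∃; ∃-syntax; _×_; _,_)
open import Data.Sum.Base using (_⊎_)
open import Function.Bundles using (_⇔_; _↔_; Inverse)
open import Induction.WellFounded using (WellFounded)
open import Level using (0ℓ)
open import Relation.Binary.Construct.Closure.Symmetric
  using (SymClosure; fwd; bwd; symmetric)
open import Relation.Binary.Core using (Rel)
open import Relation.Binary.Definitions using (Symmetric; Irreflexive)
open import Relation.Binary.PropositionalEquality.Core
  using (_≡_; _≢_; refl)
open import Relation.Binary.Structures
  using (IsStrictPartialOrder; IsStrictTotalOrder)
open import Relation.Nullary.Negation.Core using (¬_)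
open import Relation.Unary using (Pred; _∈_; _∩_; U; Satisfiable)

-- A subset is countable if it injects into ℕ.  The injection is a total
-- function whose values off P are irrelevant, so that it cannot depend on
-- the proofs of membership.
Countable : {A : Set} → Pred A 0ℓ → Set
Countable {A} P =
  Σ (A → ℕ) λ f → ∀ {x y} → x ∈ P → y ∈ P → f x ≡ f y → x ≡ y

IsLeast : Pred ℕ 0ℓ → Pred ℕ 0ℓ
IsLeast P l = l ∈ P × (∀ {m} → m ∈ P → l ≤ m)

-- Ordinals are represented by well-ordered sets.
record Ordinal : Set₁ where
  field
    Carrier            : Set
    _<_                : Rel Carrier 0ℓ
    isStrictTotalOrder : IsStrictTotalOrder _≡_ _<_
    wellFounded        : WellFounded _<_

-- Rooted order trees: each set { s | s < t } is well-ordered.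
record Tree : Set₁ where
  field
    Node                 : Set
    _<_                  : Rel Node 0ℓ
    isStrictPartialOrder : IsStrictPartialOrder _≡_ _<_
    wellFounded          : WellFounded _<_
    predecessorsLinear   : ∀ {s s′ t} → s < t → s′ < t →
                           s < s′ ⊎ s ≡ s′ ⊎ s′ < s
    root                 : Node
    rootLeast            : ∀ t → t ≡ root ⊎ root < t

  open IsStrictPartialOrder isStrictPartialOrder public
    using () renaming (irrefl to <-irrefl; trans to <-trans)

module _ (T : Tree) where
  open Tree T

  -- t has height α: { s | s < t } has order type α.
  record HasHeight (α : Ordinal) (t : Node) : Set where
    private module α = Ordinal α
    field
      enum       : α.Carrier → Node
      below      : ∀ x → enum x < t
      surjective : ∀ {s} → s < t → ∃[ x ] enum x ≡ s
      order      : ∀ {x y} → (x α.< y) ⇔ (enum x < enum y)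

  Level : Ordinal → Pred Node 0ℓ
  Level = HasHeight

  -- heightω₁ says that the ordinals α with a nonempty level α are exactly
  -- the countable ones, i.e. that ω₁ is the least α whose level is empty.
  record IsOmega₁Tree : Set₁ where
    field
      heightω₁        : ∀ α → Satisfiable (Level α) ⇔ Countable {Ordinal.Carrier α} U
      countableLevels : ∀ α → Countable {Ordinal.Carrier α} U → Countable (Level α)

  IsChain : Pred Node 0ℓ → Set
  IsChain C = ∀ {s t} → s ∈ C → t ∈ C → s < t ⊎ s ≡ t ⊎ t < s

  record IsAronszajn : Set₁ where
    field
      isOmega₁Tree    : IsOmega₁Tree
      countableChains : ∀ C → IsChain C → Countable C

  IsAntichain : Pred Node 0ℓ → Set
  IsAntichain A = ∀ {s t} → s ∈ A → t ∈ A → ¬ (s < t)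

  IsPredecessor : Rel Node 0ℓ
  IsPredecessor u v = u < v × (∀ w → u < w → w < v → ⊥)

  IsSuccessorNode : Pred Node 0ℓ
  IsSuccessorNode v = ∃[ u ] IsPredecessor u v

  -- The root, of height 0, is neither a successor nor a limit.
  IsLimitNode : Pred Node 0ℓ
  IsLimitNode v = v ≢ root × ¬ IsSuccessorNode v

  IsSpecial : Set₁
  IsSpecial = Σ (ℕ → Pred Node 0ℓ) λ A →
    (∀ n → IsAntichain (A n)) × (∀ t → ∃[ n ] t ∈ A n)

  IsSemiSpecial : Set₁
  IsSemiSpecial = Σ (ℕ → Pred Node 0ℓ) λ A →
    (∀ n → IsAntichain (A n)) × (∀ t → IsSuccessorNode t ⇔ (∃[ n ] t ∈ A n))

  record CoversSuccessors (A : ℕ → Pred Node 0ℓ) : Set where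
    field
      antichain : ∀ n → IsAntichain (A n)
      covers    : ∀ {t} → IsSuccessorNode t → ∃[ n ] t ∈ A n

  -- Parts may be empty, so finite partitions are included.
  record IsAntichainPartition (A : ℕ → Pred Node 0ℓ) : Set where
    field
      antichain : ∀ n → IsAntichain (A n)
      covers    : ∀ t → ∃[ n ] t ∈ A n
      disjoint  : ∀ {t m n} → t ∈ A m → t ∈ A n → m ≡ n

  [root,_⟩ : Node → Pred Node 0ℓ
  [root, v ⟩ x = x < v

  ⟨_,_⟩ : Node → Node → Pred Node 0ℓ
  ⟨ u , v ⟩ x = u < x × x < v

  -- The recursion for cₙ is given by its graph, IsC A v n c meaning c = cₙ.
  -- For antichains covering the successor nodes and v of limit height this
  -- is the graph of a function of n: an antichain meets the chain below v
  -- in at most one node, and cₙ < v has a successor node between it and v.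
  module _ (A : ℕ → Pred Node 0ℓ) where

    IsChoice : Pred Node 0ℓ → Pred Node 0ℓ
    IsChoice I c =
      ∃[ l ] IsLeast (λ m → Satisfiable (A m ∩ I)) l × c ∈ A l ∩ I

    data IsC (v : Node) : ℕ → Node → Set where
      c₀ : ∀ {c} → IsChoice [root, v ⟩ c → IsC v zero c
      cₛ : ∀ {n b c} → IsC v n b → IsChoice ⟨ b , v ⟩ c → IsC v (suc n) c

    IsC-< : ∀ {v n c} → IsC v n c → c < v
    IsC-< (c₀ (_ , _ , _ , c<v))       = c<v
    IsC-< (cₛ _ (_ , _ , _ , _ , c<v)) = c<v

record Graph : Set₁ where
  field
    Vertex : Set
    Adj    : Rel Vertex 0ℓ
    sym    : Symmetric Adj
    irrefl : Irreflexive _≡_ Adj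

record _≅_ (G H : Graph) : Set where
  private
    module G = Graph G
    module H = Graph H
  field
    vertices : G.Vertex ↔ H.Vertex
    adjacent : ∀ {u v} →
      G.Adj u v ⇔ H.Adj (Inverse.to vertices u) (Inverse.to vertices v)

-- K arises from H by replacing every edge xy by a path
--   branch x = path x y 0 , … , path x y (1 + len x y) = branch y
-- with len x y new internal vertices (possibly none); path y x is the same
-- path traversed backwards.  The values of len and path at non-adjacent
-- pairs, and of path x y beyond 1 + len x y, are irrelevant.
record _IsSubdivisionOf_ (K H : Graph) : Set where
  private
    module K = Graph K
    module H = Graph H
  field
    branch    : H.Vertex → K.Vertex
    branchInj : ∀ {x y} → branch x ≡ branch y → x ≡ y
    len       : H.Vertex → H.Vertex → ℕ
    path      : H.Vertex → H.Vertex → ℕ → K.Vertex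

  Internal : H.Vertex → H.Vertex → Pred ℕ 0ℓ
  Internal x y i = 0 ℕ.< i × i ≤ len x y

  field
    start   : ∀ {x y} → H.Adj x y → path x y 0 ≡ branch x
    end     : ∀ {x y} → H.Adj x y → path x y (suc (len x y)) ≡ branch y
    lenSym  : ∀ {x y} → H.Adj x y → len y x ≡ len x y
    pathSym : ∀ {x y i} → H.Adj x y → i ≤ suc (len x y) →
              path y x i ≡ path x y (suc (len x y) ∸ i)

    internalNew : ∀ {x y z i} → H.Adj x y → i ∈ Internal x y →
                  path x y i ≢ branch z
    internalInj : ∀ {x y x′ y′ i j} → H.Adj x y → H.Adj x′ y′ →
                  i ∈ Internal x y → j ∈ Internal x′ y′ →
                  path x y i ≡ path x′ y′ j →
                  (x ≡ x′ × y ≡ y′ × i ≡ j) ⊎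
                  (x ≡ y′ × y ≡ x′ × i + j ≡ suc (len x y))

    vertices : ∀ k → (∃[ x ] branch x ≡ k) ⊎
               (∃[ x ] ∃[ y ] ∃[ i ] H.Adj x y × i ∈ Internal x y × path x y i ≡ k)
    edges    : ∀ {k l} → K.Adj k l ⇔
               (∃[ x ] ∃[ y ] ∃[ i ] H.Adj x y × i ≤ len x y ×
                 k ≡ path x y i × l ≡ path x y (suc i))

module RayInflation (T : Tree) (A : ℕ → Pred (Tree.Node T) 0ℓ) where
  open Tree T

  data Edge : Rel (Node × ℕ) 0ℓ where
    ray   : ∀ {u n} → Edge (u , n) (u , suc n)
    succ  : ∀ {u v n} → IsPredecessor T u v → Edge (u , n) (v , n)
    limit : ∀ {v n c} → IsLimitNode T v → IsC T A v n c → Edge (c , n) (v , n)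

  Edge-irrefl : ∀ {p} → ¬ Edge p p
  Edge-irrefl (succ (u<u , _)) = <-irrefl refl u<u
  Edge-irrefl (limit _ c)      = <-irrefl refl (IsC-< T A c)

  graph : Graph
  graph = record
    { Vertex = Node × ℕ
    ; Adj    = SymClosure Edge
    ; sym    = symmetric Edge
    ; irrefl = λ { refl (fwd e) → Edge-irrefl e ; refl (bwd e) → Edge-irrefl e }
    }

-- T #ℕ A is the graph T#ℕ built from T and the sequence of antichains A.
_#ℕ_ : (T : Tree) → (ℕ → Pred (Tree.Node T) 0ℓ) → Graph
T #ℕ A = RayInflation.graph T A

{-# OPTIONS --safe #-}
module Submission where

-- Idea.  Send each vertex p of T # ℕ to a node ν p of S: a branch vertex to its
-- own node, an internal vertex to the larger end of the subdivided edge.  Then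
-- ν maps adjacent vertices to comparable nodes, and only countably many p have
-- ν p ≤ r.  Put t ▷ t′ if t′ ≤ t or ν (t′ , n) ≤ ν (t , 0) for some n; the
-- closure of a node under ▷ is countable.  For t ∈ T let a ≤ t be least with t
-- in the closure of a, and let Y be the down-set of S spanned by the closures of
-- the nodes below a.  No node above a lies in these closures and the cone above
-- a is connected, so ν maps the cone into the cone of S above a single minimal
-- node r of S ∖ Y.  The colour of r in S together with the index of t in the
-- closure of a colours T properly, which would make T special.

open import Defs
open import Axiom.ExcludedMiddle using (ExcludedMiddle)
open import Data.Empty using (⊥; ⊥-elim)
open import Data.List.Base using (List; []; _∷_)
open import Data.List.Properties using (∷-injective)
open import Data.Nat.Base as ℕ using (ℕ; zero; suc; z≤n; s≤s; _*_)
open import Data.Nat.Induction using (<-wellFounded)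
import Data.Nat.Properties as ℕ
open import Data.Product.Base using (∃-syntax; _×_; _,_; proj₁; proj₂)
open import Data.Sum.Base using (_⊎_; inj₁; inj₂; [_,_]′)
open import Function.Base using (_∘_)
open import Function.Bundles using (Equivalence; Inverse)
open import Induction.WellFounded using (WellFounded; Acc; acc)
open import Level using (0ℓ)
open import Relation.Binary.Construct.Closure.ReflexiveTransitive
  using (Star; ε; _◅_; _◅◅_)
open import Relation.Binary.Construct.Closure.Symmetric using (fwd; bwd)
import Relation.Binary.Construct.StrictToNonStrict as NonStrict
open import Relation.Binary.Core using (Rel)
open import Relation.Binary.PropositionalEquality
  using (_≡_; _≢_; refl; sym; trans; cong; subst; resp₂; isEquivalence; respʳ; respˡ)
open import Relation.Nullary.Decidable.Core using (Dec; yes; no)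
open import Relation.Nullary.Negation.Core using (¬_; contradiction)
open import Relation.Unary using (Pred; _∈_; _∉_; _∪_; _∩_; Satisfiable)

-- Injective coding of finite lists of naturals.

-- pair m n = 2ᵐ (2n + 1)
pair : ℕ → ℕ → ℕ
pair zero    n = suc (2 * n)
pair (suc m) n = 2 * pair m n

pair≢0 : ∀ m n → pair m n ≢ 0
pair≢0 (suc m) n eq = pair≢0 m n (ℕ.*-cancelˡ-≡ _ 0 2 eq)

pair-injective : ∀ m n m′ n′ → pair m n ≡ pair m′ n′ → m ≡ m′ × n ≡ n′
pair-injective zero    n zero     n′ eq = refl , ℕ.*-cancelˡ-≡ n n′ 2 (ℕ.suc-injective eq)
pair-injective zero    n (suc m′) n′ eq = contradiction (sym eq) (ℕ.even≢odd (pair m′ n′) n)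
pair-injective (suc m) n zero     n′ eq = contradiction eq (ℕ.even≢odd (pair m n) n′)
pair-injective (suc m) n (suc m′) n′ eq
  with pair-injective m n m′ n′ (ℕ.*-cancelˡ-≡ _ _ 2 eq)
... | refl , refl = refl , refl

-- `pair` never takes the value 0, which leaves 0 free for the empty list.
code : List ℕ → ℕ
code []       = 0
code (n ∷ ns) = pair n (code ns)

code-injective : ∀ ms ns → code ms ≡ code ns → ms ≡ ns
code-injective []       []       eq = refl
code-injective []       (n ∷ ns) eq = contradiction (sym eq) (pair≢0 n (code ns))
code-injective (m ∷ ms) []       eq = contradiction eq (pair≢0 m (code ms))
code-injective (m ∷ ms) (n ∷ ns) eq with pair-injective m (code ms) n (code ns) eq
... | refl , eq′ with code-injective ms ns eq′
... | refl = refl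

-- The reflexive order of a tree and the edges of ray inflations.

module TreeOrder (T : Tree) where
  open Tree T

  open NonStrict _≡_ _<_ public using (_≤_)

  ≤-refl : ∀ {t} → t ≤ t
  ≤-refl = inj₂ refl

  ≤-trans : ∀ {s t u} → s ≤ t → t ≤ u → s ≤ u
  ≤-trans = NonStrict.trans _≡_ _<_ isEquivalence (resp₂ _<_) <-trans

  <-≤-trans : ∀ {s t u} → s < t → t ≤ u → s < u
  <-≤-trans = NonStrict.<-≤-trans _≡_ _<_ <-trans (respʳ _<_)

  ≤-<-trans : ∀ {s t u} → s ≤ t → t < u → s < u
  ≤-<-trans = NonStrict.≤-<-trans _≡_ _<_ sym <-trans (respˡ _<_)

  compare : ∀ {s t u} → s ≤ u → t ≤ u → s < t ⊎ s ≡ t ⊎ t < s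
  compare (inj₁ s<u)  (inj₁ t<u)  = predecessorsLinear s<u t<u
  compare (inj₁ s<u)  (inj₂ refl) = inj₁ s<u
  compare (inj₂ refl) (inj₁ t<u)  = inj₂ (inj₂ t<u)
  compare (inj₂ refl) (inj₂ refl) = inj₂ (inj₁ refl)

  downset-countable : IsAronszajn T → ∀ u → Countable (_≤ u)
  downset-countable aronszajn u =
    IsAronszajn.countableChains aronszajn (_≤ u) compare

#ℕ-comparable : ∀ S B {x y} → Graph.Adj (S #ℕ B) x y → let open TreeOrder S in
                proj₁ x ≤ proj₁ y ⊎ proj₁ y ≤ proj₁ x
#ℕ-comparable S B = λ where
    (fwd e) → inj₁ (edge e)
    (bwd e) → inj₂ (edge e)
  where
  open TreeOrder S
  open RayInflation S B
  edge : ∀ {x y} → Edge x y → proj₁ x ≤ proj₁ y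
  edge ray              = inj₂ refl
  edge (succ (u<v , _)) = inj₁ u<v
  edge (limit _ c)      = inj₁ (IsC-< S B c)

-- Minimal elements and countable sets under excluded middle.

module Classical (em : ExcludedMiddle 0ℓ) where

  minimal : {A : Set} {_<_ : Rel A 0ℓ} → WellFounded _<_ →
            (P : Pred A 0ℓ) → Satisfiable P →
            ∃[ x ] x ∈ P × (∀ {y} → y < x → y ∉ P)
  minimal {_<_ = _<_} wf P (x , px) = go x (wf x) px
    where
    go : ∀ x → Acc _<_ x → x ∈ P → ∃[ x ] x ∈ P × (∀ {y} → y < x → y ∉ P)
    go x (acc rec) px with em {∃[ y ] y < x × y ∈ P}
    ... | yes (y , y<x , py) = go y (rec y<x) py
    ... | no none            = x , px , λ y<x py → none (_ , y<x , py)

  least : (P : Pred ℕ 0ℓ) → Satisfiable P → ∃[ l ] IsLeast P l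
  least P sat with minimal <-wellFounded P sat
  ... | l , pl , min = l , pl , λ pm → ℕ.≮⇒≥ λ m<l → min m<l pm

  ∪-countable : {A : Set} {P Q : Pred A 0ℓ} →
                Countable P → Countable Q → Countable (P ∪ Q)
  ∪-countable {A} {P} {Q} (f , f-inj) (g , g-inj) = h , h-inj
    where
    -- The tag 0 or 1 records which injection is used; deciding by `em` makes the value depend on
    -- `x` alone.
    h′ : ∀ x → Dec (x ∈ P) → List ℕ
    h′ x (yes _) = 0 ∷ f x ∷ []
    h′ x (no  _) = 1 ∷ g x ∷ []
    h : A → ℕ
    h x = code (h′ x em)
    h′-inj : ∀ {x y} → x ∈ P ∪ Q → y ∈ P ∪ Q → (dx : Dec (x ∈ P)) (dy : Dec (y ∈ P)) →
             h′ x dx ≡ h′ y dy → x ≡ y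
    h′-inj _ _ (yes px) (yes py) eq = f-inj px py (proj₁ (∷-injective (proj₂ (∷-injective eq))))
    h′-inj (inj₁ px) _ (no ¬px) (no _) _ = contradiction px ¬px
    h′-inj (inj₂ _) (inj₁ py) (no _) (no ¬py) _ = contradiction py ¬py
    h′-inj (inj₂ qx) (inj₂ qy) (no _) (no _) eq =
      g-inj qx qy (proj₁ (∷-injective (proj₂ (∷-injective eq))))
    h-inj : ∀ {x y} → x ∈ P ∪ Q → y ∈ P ∪ Q → h x ≡ h y → x ≡ y
    h-inj px py eq = h′-inj px py em em (code-injective _ _ eq)

  -- A walk from `x` is determined by the indices of the points it visits in turn, so its end is
  -- determined by a finite list of naturals.
  star-countable : {A : Set} {R : Rel A 0ℓ} →
                   (∀ x → Countable (R x)) → ∀ x → Countable (Star R x)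
  star-countable {A} {R} cnt x = index , index-inj
    where
    codes : ∀ {x y} → Star R x y → List ℕ
    codes ε                    = []
    codes (_◅_ {x} {y} _ rest) = proj₁ (cnt x) y ∷ codes rest
    codes-inj : ∀ {x y z} (p : Star R x y) (q : Star R x z) → codes p ≡ codes q → y ≡ z
    codes-inj ε       ε       eq = refl
    codes-inj {x} (r ◅ p) (s ◅ q) eq
      with ∷-injective eq
    ... | head , tail with proj₂ (cnt x) r s head
    ... | refl = codes-inj p q tail
    index′ : ∀ {y} → Dec (Star R x y) → ℕ
    index′ (yes p) = code (codes p)
    index′ (no _)  = 0
    index : A → ℕ
    index y = index′ {y} em
    index′-inj : ∀ {y z} → Star R x y → Star R x z →
                 (d : Dec (Star R x y)) (e : Dec (Star R x z)) → index′ d ≡ index′ e → y ≡ z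
    index′-inj _ _ (yes p) (yes q) eq = codes-inj p q (code-injective _ _ eq)
    index′-inj p _ (no ¬p) _       _  = contradiction p ¬p
    index′-inj _ q _       (no ¬q) _  = contradiction q ¬q
    index-inj : ∀ {y z} → Star R x y → Star R x z → index y ≡ index z → y ≡ z
    index-inj p q = index′-inj p q em em

  -- Connectedness of cones in `T #ℕ A`.

  module Cones (T : Tree) {A : ℕ → Pred (Tree.Node T) 0ℓ} (cov : CoversSuccessors T A) where
    open Tree T
    open TreeOrder T
    open CoversSuccessors cov

    -- If the interval were empty, `b` would be a predecessor of `v`; a minimal node of the interval
    -- has predecessor `b`.
    successor-between : ∀ {b v} → IsLimitNode T v → b < v →
                        ∃[ w ] IsSuccessorNode T w × w ∈ ⟨_,_⟩ T b v
    successor-between {b} {v} (_ , ¬succ) b<v with em {Satisfiable (⟨_,_⟩ T b v)}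
    ... | no none = contradiction (b , b<v , λ w b<w w<v → none (w , b<w , w<v)) ¬succ
    ... | yes sat with minimal wellFounded (⟨_,_⟩ T b v) sat
    ... | w , (b<w , w<v) , min =
      w , (b , b<w , λ x b<x x<w → min x<w (b<x , <-trans x<w w<v)) , b<w , w<v

    choose : ∀ {I : Pred Node 0ℓ} {w} → IsSuccessorNode T w → w ∈ I → ∃[ c ] IsChoice T A I c
    choose {I} {w} succ-w w∈I
      with least (λ m → Satisfiable (A m ∩ I)) (_ , w , proj₂ (covers succ-w) , w∈I)
    ... | l , isLeast@((c , c∈) , _) = c , l , isLeast , c∈

    -- Provides an edge down from the limit node `v` that stays in the cone above `a`.
    c-cofinal : ∀ {v a} → IsLimitNode T v → a < v → ∃[ n ] ∃[ c ] IsC T A v n c × a ≤ c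
    c-cofinal {v} {a} lim@(v≢root , _) a<v with successor-between lim a<v
    ... | w , succ-w , a<w , w<v with covers succ-w
    ... | L , w∈AL = first
      where
      Goal = ∃[ n ] ∃[ c ] IsC T A v n c × a ≤ c

      -- The indices of the antichains containing the cₙ increase strictly, and
      -- they stay ≤ L as long as cₙ < w; m counts the remaining steps.
      go : ∀ m {n c} {I : Pred Node 0ℓ} → IsC T A v n c → (ch : IsChoice T A I c) →
           (∀ {x} → c < x → x < v → x ∈ I) →
           L ℕ.< proj₁ ch ℕ.+ m → Goal
      -- By `I-up`, nodes between `c` and `v` competed when `l` was chosen as least: `w` yields
      -- `l ≤ L`, and the next choice `c′` yields `l ≤ l′`, strictly since `c < c′` cannot share an
      -- antichain.
      go m {n} {c} {I} isC (l , (_ , l-min) , c∈Al , _) I-up L<l+m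
        with predecessorsLinear a<v (IsC-< T A isC)
      ... | inj₁ a<c          = n , c , isC , inj₁ a<c
      ... | inj₂ (inj₁ a≡c)   = n , c , isC , inj₂ a≡c
      ... | inj₂ (inj₂ c<a) = next m L<l+m
        where
        c<w = <-trans c<a a<w
        next : ∀ m → L ℕ.< l ℕ.+ m → Goal
        next zero L<l+0 = contradiction
          (ℕ.<-≤-trans (subst (L ℕ.<_) (ℕ.+-identityʳ l) L<l+0)
                       (l-min (w , w∈AL , I-up c<w w<v)))
          (ℕ.<-irrefl refl)
        next (suc m) L<l+1+m with choose {I = ⟨_,_⟩ T c v} succ-w (c<w , w<v)
        ... | c′ , ch@(l′ , _ , c′∈Al′ , c<c′ , c′<v) =
          go m (cₛ isC ch) ch (λ c′<x x<v → <-trans c<c′ c′<x , x<v)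
             (ℕ.<-≤-trans (subst (L ℕ.<_) (ℕ.+-suc l m) L<l+1+m) (ℕ.+-monoˡ-≤ m l<l′))
          where
          l<l′ : l ℕ.< l′
          l<l′ = ℕ.≤∧≢⇒< (l-min (c′ , c′∈Al′ , I-up c<c′ c′<v))
                   λ { refl → antichain l c∈Al c′∈Al′ c<c′ }

      first : Goal
      first with choose {I = [root,_⟩ T v} succ-w w<v
      ... | c , ch@(l , _) = go (suc L) (c₀ ch) ch (λ _ x<v → x<v) (ℕ.m≤n+m (suc L) l)

    ≢root : ∀ {a t} → a < t → t ≢ root
    ≢root {a} a<t refl with rootLeast a
    ... | inj₁ refl   = <-irrefl refl a<t
    ... | inj₂ root<a = <-irrefl refl (<-trans root<a a<t)

    -- Connectedness of the cone above a, as an induction principle.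
    cone-induction : ∀ {a} (P : Pred (Node × ℕ) 0ℓ) → (a , 0) ∈ P →
      (∀ {p q} → a ≤ proj₁ p → a ≤ proj₁ q → Graph.Adj (T #ℕ A) p q → p ∈ P → q ∈ P) →
      ∀ {t n} → a ≤ t → (t , n) ∈ P
    cone-induction {a} P base step = go (wellFounded _)
      where
      along : ∀ {t n m} → a ≤ t → (t , n) ∈ P → (t , m) ∈ P
      along {t} a≤t = up _ ∘ down _
        where
        open RayInflation T A
        down : ∀ n → (t , n) ∈ P → (t , 0) ∈ P
        down zero    p = p
        down (suc n) p = down n (step a≤t a≤t (bwd ray) p)
        up : ∀ m → (t , 0) ∈ P → (t , m) ∈ P
        up zero    p = p
        up (suc m) p = step a≤t a≤t (fwd ray) (up m p)

      go : ∀ {t n} → Acc _<_ t → a ≤ t → (t , n) ∈ P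
      go _ (inj₂ refl) = along ≤-refl base
      go {t} (acc rec) a≤t@(inj₁ a<t) with em {IsSuccessorNode T t}
      ... | yes (u , u-pred@(u<t , gap)) =
        along a≤t (step a≤u a≤t (fwd (RayInflation.succ u-pred)) (go {n = 0} (rec u<t) a≤u))
        where
        a≤u : a ≤ u
        a≤u with predecessorsLinear a<t u<t
        ... | inj₁ a<u        = inj₁ a<u
        ... | inj₂ (inj₁ a≡u) = inj₂ a≡u
        ... | inj₂ (inj₂ u<a) = ⊥-elim (gap a u<a a<t)
      ... | no ¬succ with c-cofinal (≢root a<t , ¬succ) a<t
      -- This edge lies in layer `n` only, so the induction hypothesis is needed for every layer;
      -- `along` then spreads `P` over the ray of `t`.
      ... | n , c , isC , a≤c =
        along a≤t (step a≤c a≤t (fwd (RayInflation.limit (≢root a<t , ¬succ) isC)) (go (rec (IsC-< T A isC)) a≤c))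

  -- A proper colouring of `T` obtained from one of `S` through `ν`.

  module Transfer
    (T : Tree) {A : ℕ → Pred (Tree.Node T) 0ℓ} (cov : CoversSuccessors T A)
    (T-countable : ∀ t → Countable (λ s → TreeOrder._≤_ T s t))
    (S : Tree) (S-special : IsSpecial S)
    (ν : Tree.Node T × ℕ → Tree.Node S)
    (ν-comparable : ∀ {p q} → Graph.Adj (T #ℕ A) p q →
                    TreeOrder._≤_ S (ν p) (ν q) ⊎ TreeOrder._≤_ S (ν q) (ν p))
    (ν-countable : ∀ r → Countable (λ p → TreeOrder._≤_ S (ν p) r))
    where

    private
      module T where
        open Tree T public
        open TreeOrder T public
      module S where
        open Tree S public
        open TreeOrder S public

    infix 4 _▷_ _▷*_
    _▷_ : Rel T.Node 0ℓ
    t ▷ t′ = t′ T.≤ t ⊎ ∃[ n ] ν (t′ , n) S.≤ ν (t , 0)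

    _▷*_ : Rel T.Node 0ℓ
    _▷*_ = Star _▷_

    ▷-countable : ∀ t → Countable (t ▷_)
    ▷-countable t = ∪-countable (T-countable t) (f , f-inj)
      where
      Q : Pred T.Node 0ℓ
      Q t′ = ∃[ n ] ν (t′ , n) S.≤ ν (t , 0)
      index = proj₁ (ν-countable (ν (t , 0)))
      -- The layer `n` is the one supplied by `em`, hence a function of `t′`.
      f′ : ∀ t′ → Dec (t′ ∈ Q) → ℕ
      f′ t′ (yes (n , _)) = index (t′ , n)
      f′ t′ (no _)        = 0
      f : T.Node → ℕ
      f t′ = f′ t′ em
      f′-inj : ∀ {x y} → x ∈ Q → y ∈ Q → (dx : Dec (x ∈ Q)) (dy : Dec (y ∈ Q)) →
               f′ x dx ≡ f′ y dy → x ≡ y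
      f′-inj _ _ (yes (_ , p)) (yes (_ , q)) eq =
        cong proj₁ (proj₂ (ν-countable (ν (t , 0))) p q eq)
      f′-inj p _ (no ¬p) _ _ = contradiction p ¬p
      f′-inj _ q _ (no ¬q) _ = contradiction q ¬q
      f-inj : ∀ {x y} → x ∈ Q → y ∈ Q → f x ≡ f y → x ≡ y
      f-inj p q = f′-inj p q em em

    X : T.Node → Pred T.Node 0ℓ
    X a x = ∃[ s ] s T.< a × s ▷* x

    Y : T.Node → Pred S.Node 0ℓ
    Y a r = ∃[ x ] x ∈ X a × r S.≤ ν (x , 0)

    X-down : ∀ {a x y} → y T.≤ x → x ∈ X a → y ∈ X a
    X-down y≤x (s , s<a , s▷x) = s , s<a , s▷x ◅◅ inj₁ y≤x ◅ ε

    Y-down : ∀ {a r s} → s S.≤ r → r ∈ Y a → s ∈ Y a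
    Y-down s≤r (x , x∈X , r≤νx) = x , x∈X , S.≤-trans s≤r r≤νx

    -- The second clause of `_▷_` is designed for this: it absorbs each node having a vertex that
    -- `ν` sends into `Y a`.
    ν∈Y⇒X : ∀ {a t n} → ν (t , n) ∈ Y a → t ∈ X a
    ν∈Y⇒X (x , (s , s<a , s▷x) , ν≤) = s , s<a , s▷x ◅◅ inj₂ (_ , ν≤) ◅ ε

    module Root {a} (a∉X : a ∉ X a) where

      private
        min-outside = minimal S.wellFounded (λ r → r S.≤ ν (a , 0) × r ∉ Y a)
                        (ν (a , 0) , S.≤-refl , a∉X ∘ ν∈Y⇒X)

      r : S.Node
      r = proj₁ min-outside

      r≤νa : r S.≤ ν (a , 0)
      r≤νa = proj₁ (proj₁ (proj₂ min-outside))

      r∉Y : r ∉ Y a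
      r∉Y = proj₂ (proj₁ (proj₂ min-outside))

      below-r∉Y : ∀ {s} → s S.< r → ¬ (s ∉ Y a)
      below-r∉Y s<r s∉Y =
        proj₂ (proj₂ min-outside) s<r (inj₁ (S.<-≤-trans s<r r≤νa) , s∉Y)

      -- Along an edge `ν` moves between comparable nodes, so it can leave the cone above `r` only
      -- by dropping strictly below `r`, that is into `Y a`. Then the node reached, and with it `a`,
      -- would lie in `X a`.
      r≤ν-cone : ∀ {t n} → a T.≤ t → r S.≤ ν (t , n)
      r≤ν-cone = Cones.cone-induction T cov (λ p → r S.≤ ν p) r≤νa step
        where
        step : ∀ {p q} → a T.≤ proj₁ p → a T.≤ proj₁ q → Graph.Adj (T #ℕ A) p q →
               r S.≤ ν p → r S.≤ ν q
        step _ a≤q adj r≤νp with ν-comparable adj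
        ... | inj₁ νp≤νq = S.≤-trans r≤νp νp≤νq
        ... | inj₂ νq≤νp with S.compare r≤νp νq≤νp
        ... | inj₁ r<νq        = inj₁ r<νq
        ... | inj₂ (inj₁ r≡νq) = inj₂ r≡νq
        ... | inj₂ (inj₂ νq<r) = ⊥-elim (below-r∉Y νq<r (a∉X ∘ X-down a≤q ∘ ν∈Y⇒X))

    IsBase : T.Node → Pred T.Node 0ℓ
    IsBase t a = a T.≤ t × a ▷* t

    minimal-base : ∀ t → ∃[ a ] a ∈ IsBase t × (∀ {s} → s T.< a → s ∉ IsBase t)
    minimal-base t = minimal T.wellFounded (IsBase t) (t , T.≤-refl , ε)

    base : T.Node → T.Node
    base t = proj₁ (minimal-base t)

    base≤ : ∀ t → base t T.≤ t
    base≤ t = proj₁ (proj₁ (proj₂ (minimal-base t)))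

    base▷* : ∀ t → base t ▷* t
    base▷* t = proj₂ (proj₁ (proj₂ (minimal-base t)))

    base-min : ∀ t {s} → s T.< base t → ¬ (s ▷* t)
    base-min t s<a s▷*t =
      proj₂ (proj₂ (minimal-base t)) s<a (inj₁ (T.<-≤-trans s<a (base≤ t)) , s▷*t)

    -- A smaller node reaching `base t` would also reach `t`, against minimality.
    base∉X : ∀ t → base t ∉ X (base t)
    base∉X t (s , s<a , s▷a) = base-min t s<a (s▷a ◅◅ base▷* t)

    module R t = Root (base∉X t)

    colourS : S.Node → ℕ
    colourS r = proj₁ (proj₂ (proj₂ S-special) r)

    colourS-proper : ∀ {r s} → colourS r ≡ colourS s → ¬ (r S.< s)
    colourS-proper {r} {s} eq =
      proj₁ (proj₂ S-special) _ (proj₂ (proj₂ (proj₂ S-special) r))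
        (subst (λ n → s ∈ proj₁ S-special n) (sym eq) (proj₂ (proj₂ (proj₂ S-special) s)))

    index : ∀ a → Countable (a ▷*_)
    index = star-countable ▷-countable

    -- The first component handles comparable nodes with different bases, the second distinct nodes
    -- with a common base.
    colour : T.Node → ℕ
    colour t = pair (colourS (R.r t)) (proj₁ (index (base t)) t)

    colour-proper : ∀ {t u} → colour t ≡ colour u → ¬ (t T.< u)
    colour-proper {t} {u} eq t<u
      with pair-injective (colourS (R.r t)) _ (colourS (R.r u)) _ eq
         | T.compare (T.≤-trans (base≤ t) (inj₁ t<u)) (base≤ u)
    -- Both roots lie below `ν (base u , 0)`, hence are comparable. Only the root of `t` is in the
    -- down-set `Y (base u)`, so it is strictly below the root of `u`, although their colours agree.
    ... | eqS , _ | inj₁ a<b = absurd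
      where
      rt∈Yu : R.r t ∈ Y (base u)
      rt∈Yu = base t , (base t , a<b , ε) , R.r≤νa t
      absurd : ⊥
      absurd with S.compare (R.r≤ν-cone t (inj₁ a<b)) (R.r≤νa u)
      ... | inj₁ rt<ru        = colourS-proper eqS rt<ru
      ... | inj₂ (inj₁ rt≡ru) = R.r∉Y u (subst (_∈ Y (base u)) rt≡ru rt∈Yu)
      ... | inj₂ (inj₂ ru<rt) = R.r∉Y u (Y-down (inj₁ ru<rt) rt∈Yu)
    ... | _ , eqI | inj₂ (inj₁ a≡b) = T.<-irrefl t≡u t<u
      where
      t≡u : t ≡ u
      t≡u = proj₂ (index (base t)) (base▷* t) (subst (_▷* u) (sym a≡b) (base▷* u))
              (trans eqI (cong (λ a → proj₁ (index a) u) (sym a≡b)))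
    -- Since `t < u`, the closure of `base u` contains `t`, contradicting the minimality of
    -- `base t`.
    ... | _ | inj₂ (inj₂ b<a) =
      base-min t b<a (base▷* u ◅◅ inj₁ (inj₁ t<u) ◅ ε)

    special : IsSpecial T
    special = (λ n t → colour t ≡ n)
            , (λ n eq eq′ → colour-proper (trans eq (sym eq′)))
            , λ t → colour t , refl

  -- The map from a subdivision of `S #ℕ B` to the nodes of `S`.

  module Subdivision
    {S : Tree} {B : ℕ → Pred (Tree.Node S) 0ℓ}
    (S-countable : ∀ s → Countable (λ r → TreeOrder._≤_ S r s))
    {K : Graph} (sub : K IsSubdivisionOf (S #ℕ B))
    where

    open TreeOrder S
    open Tree S using (Node)
    open _IsSubdivisionOf_ sub
    private
      module K = Graph K
      module H = Graph (S #ℕ B)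

    Position : Pred K.Vertex 0ℓ
    Position k = (∃[ x ] branch x ≡ k) ⊎
      (∃[ x ] ∃[ y ] ∃[ i ] H.Adj x y × i ∈ Internal x y × path x y i ≡ k)

    top : ∀ {x y} → H.Adj x y → Node
    top {x} {y} adj = [ (λ _ → proj₁ y) , (λ _ → proj₁ x) ]′ (#ℕ-comparable S B adj)

    left≤top : ∀ {x y} (adj : H.Adj x y) → proj₁ x ≤ top adj
    left≤top adj with #ℕ-comparable S B adj
    ... | inj₁ x≤y = x≤y
    ... | inj₂ _   = ≤-refl

    right≤top : ∀ {x y} (adj : H.Adj x y) → proj₁ y ≤ top adj
    right≤top adj with #ℕ-comparable S B adj
    ... | inj₁ _   = ≤-refl
    ... | inj₂ y≤x = y≤x

    top-end : ∀ {x y} (adj : H.Adj x y) → top adj ≡ proj₁ x ⊎ top adj ≡ proj₁ y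
    top-end adj with #ℕ-comparable S B adj
    ... | inj₁ _ = inj₂ refl
    ... | inj₂ _ = inj₁ refl

    node′ : ∀ {k} → Position k → Node
    node′ (inj₁ (x , _))               = proj₁ x
    node′ (inj₂ (_ , _ , _ , adj , _)) = top adj

    node : K.Vertex → Node
    node k = node′ (vertices k)

    IsEnd : H.Vertex → H.Vertex → Pred Node 0ℓ
    IsEnd x y s = s ≡ proj₁ x ⊎ s ≡ proj₁ y

    node-branch : ∀ z → node (branch z) ≡ proj₁ z
    node-branch z with vertices (branch z)
    ... | inj₁ (x , eq)                         = cong proj₁ (branchInj eq)
    ... | inj₂ (_ , _ , _ , adj , internal , eq) = contradiction eq (internalNew adj internal)

    -- `vertices` may present the vertex on the reversed path; `internalInj` shows that this at most
    -- swaps the two ends.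
    node-internal : ∀ {x y i} → H.Adj x y → i ∈ Internal x y → node (path x y i) ∈ IsEnd x y
    node-internal {x} {y} {i} adj internal with vertices (path x y i)
    ... | inj₁ (_ , eq) = contradiction (sym eq) (internalNew adj internal)
    ... | inj₂ (_ , _ , _ , adj′ , internal′ , eq)
      with internalInj adj′ adj internal′ internal eq | top-end adj′
    ... | inj₁ (refl , refl , _) | end′      = end′
    ... | inj₂ (refl , refl , _) | inj₁ left  = inj₂ left
    ... | inj₂ (refl , refl , _) | inj₂ right = inj₁ right

    node-path : ∀ {x y i} → H.Adj x y → i ℕ.≤ suc (len x y) → node (path x y i) ∈ IsEnd x y
    node-path {x} {y} {zero} adj _ =
      inj₁ (trans (cong node (start adj)) (node-branch x))
    node-path {x} {y} {suc i} adj i≤ with ℕ.m≤n⇒m<n∨m≡n i≤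
    ... | inj₁ (s≤s i<len) = node-internal adj (s≤s z≤n , i<len)
    ... | inj₂ refl        = inj₂ (trans (cong node (end adj)) (node-branch y))

    -- Consecutive vertices of a path are sent to ends of one edge of `S #ℕ B`, and those ends are
    -- comparable.
    node-comparable : ∀ {k l} → K.Adj k l → node k ≤ node l ⊎ node l ≤ node k
    node-comparable k~l with Equivalence.to edges k~l
    ... | x , y , i , adj , i≤len , refl , refl =
      ends (node-path adj (ℕ.m≤n⇒m≤1+n i≤len)) (node-path adj (s≤s i≤len))
           (#ℕ-comparable S B adj)
      where
      ends : ∀ {s t u v} → s ≡ u ⊎ s ≡ v → t ≡ u ⊎ t ≡ v → u ≤ v ⊎ v ≤ u → s ≤ t ⊎ t ≤ s
      ends (inj₁ refl) (inj₁ refl) _          = inj₁ ≤-refl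
      ends (inj₂ refl) (inj₂ refl) _          = inj₁ ≤-refl
      ends (inj₁ refl) (inj₂ refl) comparable = comparable
      ends (inj₂ refl) (inj₁ refl) (inj₁ u≤v) = inj₂ u≤v
      ends (inj₂ refl) (inj₁ refl) (inj₂ v≤u) = inj₁ v≤u

    -- Both ends of the subdivided edge lie below `top`, hence below `r`, so the countable indexing
    -- of the nodes below `r` identifies them.
    node-countable : ∀ r → Countable (λ k → node k ≤ r)
    node-countable r = (λ k → code (f (vertices k))) ,
      λ p q eq → f-inj (vertices _) (vertices _) p q (code-injective _ _ eq)
      where
      index = proj₁ (S-countable r)
      index-inj : ∀ {x y : H.Vertex} → proj₁ x ≤ r → proj₁ y ≤ r →
                  index (proj₁ x) ≡ index (proj₁ y) → proj₂ x ≡ proj₂ y → x ≡ y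
      index-inj {_ , m} x≤r y≤r eq refl = cong (_, m) (proj₂ (S-countable r) x≤r y≤r eq)
      f : ∀ {k} → Position k → List ℕ
      -- The differing list lengths keep branch and internal vertices apart.
      f (inj₁ ((s , m) , _)) = index s ∷ m ∷ []
      f (inj₂ ((s , m) , (t , n) , i , _)) = index s ∷ m ∷ index t ∷ n ∷ i ∷ []
      f-inj : ∀ {k l} (p : Position k) (q : Position l) → node′ p ≤ r → node′ q ≤ r →
              f p ≡ f q → k ≡ l
      f-inj (inj₁ (_ , refl)) (inj₁ (_ , refl)) p≤r q≤r eq
        with ∷-injective eq
      ... | eq₁ , eqs₁ = cong branch (index-inj p≤r q≤r eq₁ (proj₁ (∷-injective eqs₁)))
      f-inj (inj₂ (_ , _ , _ , adj , _ , refl)) (inj₂ (_ , _ , _ , adj′ , _ , refl)) p≤r q≤r eq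
        with ∷-injective eq
      ... | eq₁ , eqs₁ with ∷-injective eqs₁
      ... | eq₂ , eqs₂ with ∷-injective eqs₂
      ... | eq₃ , eqs₃ with ∷-injective eqs₃
      ... | eq₄ , eqs₄
        with index-inj (≤-trans (left≤top adj) p≤r) (≤-trans (left≤top adj′) q≤r) eq₁ eq₂
           | index-inj (≤-trans (right≤top adj) p≤r) (≤-trans (right≤top adj′) q≤r) eq₃ eq₄
           | proj₁ (∷-injective eqs₄)
      ... | refl | refl | refl = refl

mainTheorem5 : (∀ {ℓ} → ExcludedMiddle ℓ) →
    (T : Tree) → IsAronszajn T → IsSemiSpecial T → ¬ IsSpecial T →
    (A : ℕ → Pred (Tree.Node T) 0ℓ) → CoversSuccessors T A →
    (S : Tree) → IsAronszajn S → IsSpecial S →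
    (B : ℕ → Pred (Tree.Node S) 0ℓ) → IsAntichainPartition S B →
    (G : Graph) → G ≅ (T #ℕ A) → ¬ (G IsSubdivisionOf (S #ℕ B))
-- `node ∘ from` serves as `ν`: the isomorphism carries comparability and countability over to
-- `T #ℕ A`.
mainTheorem5 em T T-aronszajn _ ¬special A cov S S-aronszajn S-special B _ G iso sub =
  ¬special (Transfer.special T cov (TreeOrder.downset-countable T T-aronszajn)
    S S-special (node ∘ from) comparable countable)
  where
  open Classical em
  open Subdivision (TreeOrder.downset-countable S S-aronszajn) sub
  open _≅_ iso
  open Inverse vertices using (to; from; strictlyInverseˡ)

  comparable : ∀ {p q} → Graph.Adj (T #ℕ A) p q →
    TreeOrder._≤_ S (node (from p)) (node (from q)) ⊎
    TreeOrder._≤_ S (node (from q)) (node (from p))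
  comparable {p} {q} p~q = node-comparable (Equivalence.from adjacent p~q′)
    where
    p~q′ : Graph.Adj (T #ℕ A) (to (from p)) (to (from q))
    p~q′ rewrite strictlyInverseˡ p | strictlyInverseˡ q = p~q

  countable : ∀ r → Countable (λ p → TreeOrder._≤_ S (node (from p)) r)
  countable r with node-countable r
  ... | f , f-inj = f ∘ from , λ {p} {q} p≤r q≤r eq →
    trans (sym (strictlyInverseˡ p)) (trans (cong to (f-inj p≤r q≤r eq)) (strictlyInverseˡ q))
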